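{- Let $n\geq 2$ and let $G=S_n(a_1,a_2,\dots,a_n)$ be a palm with $1\leq a_1\leq a_2\leq\dots\leq a_n$. Suppose that $a_3\geq 2$, and that for all nonnegative integers $k\leq\log_3\left(\frac{n}{4}\right)$ we have $a_{4\cdot 3^k+1}\geq 2k+3$ and $a_{8\cdot 3^k+1}\geq 2k+4$ (each condition imposed only when the index is at most $n$). Then $\chi_L(G)=\left\lceil\log_3\left(\frac{n}{4}\right)\right\rceil+3$.
   Context: For a simple connected graph $G=(V,E)$, a $k$-coloring is a map $c:V\to\{1,\dots,k\}$ with adjacent vertices receiving different colors; $c^{ -1}(i)$ denotes the $i$-th color class, and $d(u,S)=\min_{v\in S}d(u,v)$. The color code of $v$ is $r_c(v)=(d(v,c^{ -1}(1)),\dots,d(v,c^{ -1}(k)))$. The coloring $c$ is a locating coloring if distinct vertices have distinct color codes. The locating chromatic number $\chi_L(G)$ is the least $k$ such that $G$ has a locating $k$-coloring. For $n\geq 2$ and positive integers $a_1,\dots,a_n$, the palm $S_n(a_1,\dots,a_n)$ is the tree consisting of $n$ paths of lengths $a_1,\dots,a_n$ sharing one common endpoint (the hub), otherwise disjoint. -}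

module Defs where

open import Data.Nat using (ℕ; zero; suc; _+_; _*_; _^_; _≤_; _<_)
open import Data.Fin using (Fin; toℕ; fromℕ<)
open import Data.Product using (Σ; ∃; _×_; _,_)
open import Relation.Binary.PropositionalEquality using (_≡_; _≢_)
open import Relation.Nullary using (¬_)

module _ {V : Set} (Adj : V → V → Set) where

  data Walk : V → V → ℕ → Set where
    here : ∀ {u} → Walk u u 0
    step : ∀ {u w v m} → Adj u w → Walk w v m → Walk u v (suc m)

  Dist : V → V → ℕ → Set
  Dist u v m = Walk u v m × (∀ m′ → Walk u v m′ → m ≤ m′)

  DistToClass : ∀ {k} → (V → Fin k) → Fin k → V → ℕ → Set
  DistToClass c i u m =
    (∃ λ v → c v ≡ i × Walk u v m) ×
    (∀ v m′ → c v ≡ i → Walk u v m′ → m ≤ m′)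

  Proper : ∀ k → (V → Fin k) → Set
  Proper k c = ∀ u v → Adj u v → c u ≢ c v

  SameCode : ∀ {k} → (V → Fin k) → V → V → Set
  SameCode c u v = ∀ i m → (DistToClass c i u m → DistToClass c i v m)
                         × (DistToClass c i v m → DistToClass c i u m)

  Locating : ∀ k → (V → Fin k) → Set
  Locating k c = Proper k c × (∀ u v → SameCode c u v → u ≡ v)

  LocChromNum : ℕ → Set
  LocChromNum m =
    (Σ (V → Fin m) λ c → Locating m c) ×
    (∀ k → k < m → ∀ (c : V → Fin k) → ¬ Locating k c)

-- The palm S_n(a_1,…,a_n).  Legs indexed by Fin n (0-based);
-- leg i j (j : Fin (a i)) is the vertex at distance toℕ j + 1 from the hub
-- on the i-th path of length a i.

data PalmV (n : ℕ) (a : Fin n → ℕ) : Set where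
  hub : PalmV n a
  leg : (i : Fin n) → Fin (a i) → PalmV n a

data PalmAdj (n : ℕ) (a : Fin n → ℕ) : PalmV n a → PalmV n a → Set where
  hub-leg : ∀ i (j : Fin (a i)) → toℕ j ≡ 0 → PalmAdj n a hub (leg i j)
  leg-hub : ∀ i (j : Fin (a i)) → toℕ j ≡ 0 → PalmAdj n a (leg i j) hub
  out : ∀ i (j j′ : Fin (a i)) → suc (toℕ j) ≡ toℕ j′ →
        PalmAdj n a (leg i j) (leg i j′)
  inw : ∀ i (j j′ : Fin (a i)) → suc (toℕ j) ≡ toℕ j′ →
        PalmAdj n a (leg i j′) (leg i j)

at : ∀ {n} → (Fin n → ℕ) → (m : ℕ) → m < n → ℕ
at a m p = a (fromℕ< p)      -- a_{m+1} in 1-based notation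

-- t = ⌈ log₃ (n/4) ⌉  (for n ≥ 2 this is a natural number):
-- t is the least natural number with n ≤ 4·3^t.
CeilLog3Quarter : ℕ → ℕ → Set
CeilLog3Quarter n t = n ≤ 4 * 3 ^ t × (∀ s → s < t → ¬ (n ≤ 4 * 3 ^ s))

{-# OPTIONS --safe #-}

-- Lower bound.  Passing from the hub to a neighbour changes the distance to each colour class by at
-- most 1.  If s colours occur on neighbours of the hub, a neighbour's code is therefore determined by
-- its own colour (s choices), a distance 1 or 2 to each of the other s − 1 colours, and one of three
-- values for each of the at most k − 1 − s remaining colours, so n ≤ s 2^(s−1) 3^(k−1−s) ≤ 4·3^(k−3).
--
-- Upper bound.  The hub gets colour 0.  The m-th leg (from 0) is coloured alternately by two of the
-- colours 0, 1, 2, chosen by m mod 4, except that the k-th ternary digit of ⌊m / 4⌋ puts colour k + 3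
-- at distance 2k + 3 (digit 1) or 2k + 4 (digit 2) from the hub, or nowhere (digit 0); the hypotheses
-- make the leg long enough for this.  The colour among 0, 1, 2 missing from a leg reveals the depth
-- of a vertex, and then the distances to the other colours reveal m mod 4 and all the digits.
module Submission where

open import Defs
open import Data.Bool using (if_then_else_)
open import Data.Empty using (⊥; ⊥-elim)
open import Data.Nat
open import Data.Nat.DivMod
open import Data.Nat.Properties
open import Data.Nat.Tactic.RingSolver using (solve-∀)
open import Data.Fin using (Fin; zero; suc; toℕ; fromℕ<)
import Data.Fin as F
open import Data.Fin.Patterns using (0F; 1F; 2F; 3F)
open import Data.Fin.Properties as FP using (toℕ<n; toℕ-fromℕ<; toℕ-injective)
open import Data.List as List using (List; []; _∷_; _++_; length; map; cartesianProductWith; allFin)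
open import Data.List.Properties using (length-++; length-map)
open import Data.List.Membership.Propositional using (_∈_)
open import Data.List.Membership.Propositional.Properties using (∈-cartesianProductWith⁺; ∈-++⁺ˡ; ∈-++⁺ʳ; ∈-allFin)
open import Data.List.Relation.Unary.Any using (here; there; index)
open import Data.List.Relation.Unary.Any.Properties using (lookup-index)
open import Data.Parity as ℙ using (Parity; 0ℙ; 1ℙ)
open import Data.Parity.Properties as ℙ using ()
open import Data.Product using (Σ; ∃; ∃₂; _×_; _,_; proj₁; proj₂; swap)
open import Data.Sum using (_⊎_; inj₁; inj₂)
open import Data.Vec using (Vec; []; _∷_; lookup; tabulate)
open import Data.Vec.Properties using (lookup∘tabulate)
open import Relation.Binary.PropositionalEquality
open import Relation.Nullary using (¬_; Dec; yes; no; does; contradiction; _×-dec_)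
open import Relation.Unary using (Decidable)

-- Walks and distances

module _ {V : Set} {Adj : V → V → Set} where

  walk-++ : ∀ {u v w l m} → Walk Adj u v l → Walk Adj v w m → Walk Adj u w (l + m)
  walk-++ here        q = q
  walk-++ (step e p)  q = step e (walk-++ p q)

  walk-reverse : (∀ {u v} → Adj u v → Adj v u) → ∀ {u v l} → Walk Adj u v l → Walk Adj v u l
  walk-reverse sy here = here
  walk-reverse sy {l = suc l} (step e p) =
    subst (Walk Adj _ _) (+-comm l 1) (walk-++ (walk-reverse sy p) (step (sy e) here))

  module _ {k} {c : V → Fin k} where

    DistToClass-unique : ∀ {i u l m} → DistToClass Adj c i u l → DistToClass Adj c i u m → l ≡ m
    DistToClass-unique ((v , cv , p) , l≤) ((w , cw , q) , m≤) = ≤-antisym (l≤ w _ cw q) (m≤ v _ cv p)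

    DistToClass-step : ∀ {i u v l m} → Adj u v →
                       DistToClass Adj c i u l → DistToClass Adj c i v m → l ≤ suc m
    DistToClass-step e (_ , l≤) ((w , cw , q) , _) = l≤ w _ cw (step e q)

    SameCode-sym : ∀ {u v} → SameCode Adj c u v → SameCode Adj c v u
    SameCode-sym s i m = swap (s i m)

    SameCode-≡ : ∀ {i u v l m} → SameCode Adj c u v →
                 DistToClass Adj c i u l → DistToClass Adj c i v m → l ≡ m
    SameCode-≡ s p q = DistToClass-unique (proj₁ (s _ _) p) q

-- Constructive minimum: decidability lets the search start at 0, and the witness `m` bounds it.
least : ∀ {P : ℕ → Set} → Decidable P → ∀ m → P m → ∃ λ l → P l × (∀ l′ → P l′ → l ≤ l′)
least P? m pm with P? 0
... | yes p0 = 0 , p0 , λ _ _ → z≤n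
least {P} P? zero    pm | no ¬p0 = contradiction pm ¬p0
least {P} P? (suc m) pm | no ¬p0 with least (λ l → P? (suc l)) m pm
... | l , pl , min = suc l , pl , bound
  where
  bound : ∀ l′ → P l′ → suc l ≤ l′
  bound zero     p = contradiction p ¬p0
  bound (suc l′) p = s≤s (min l′ p)

∣-∣-step : ∀ m n → ∣ m - n ∣ ≤ suc ∣ suc m - n ∣
∣-∣-step m n = begin
  ∣ m - n ∣                      ≤⟨ ∣-∣-triangle m (suc m) n ⟩
  ∣ m - suc m ∣ + ∣ suc m - n ∣  ≡⟨ cong (_+ ∣ suc m - n ∣) (trans (m≤n⇒∣m-n∣≡n∸m (n≤1+n m)) (m+n∸n≡m 1 m)) ⟩
  suc ∣ suc m - n ∣              ∎
  where open ≤-Reasoning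

∣-∣-step′ : ∀ m n → ∣ suc m - n ∣ ≤ suc ∣ m - n ∣
∣-∣-step′ m n = begin
  ∣ suc m - n ∣                  ≤⟨ ∣-∣-triangle (suc m) m n ⟩
  ∣ suc m - m ∣ + ∣ m - n ∣      ≡⟨ cong (_+ ∣ m - n ∣) (trans (m≤n⇒∣n-m∣≡n∸m (n≤1+n m)) (m+n∸n≡m 1 m)) ⟩
  suc ∣ m - n ∣                  ∎
  where open ≤-Reasoning

∣m-n∣≤m+n : ∀ m n → ∣ m - n ∣ ≤ m + n
∣m-n∣≤m+n m n = ≤-trans (∣m-n∣≤m⊔n m n) (m⊔n≤m+n m n)

-- The metric of the palm

module _ {n : ℕ} {a : Fin n → ℕ} where

  private
    V = PalmV n a
    _~_ = PalmAdj n a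

  PalmAdj-sym : ∀ {u v} → u ~ v → v ~ u
  PalmAdj-sym (hub-leg i j e) = leg-hub i j e
  PalmAdj-sym (leg-hub i j e) = hub-leg i j e
  PalmAdj-sym (out i j j′ e)  = inw i j j′ e
  PalmAdj-sym (inw i j j′ e)  = out i j j′ e

  -- Closed form of the tree metric, justified by `dist≤walk` and `shortest-walk`. Positions count
  -- from 0 at the hub's neighbour, hence each `suc`.
  dist : V → V → ℕ
  dist hub       hub       = 0
  dist hub       (leg _ j) = suc (toℕ j)
  dist (leg _ j) hub       = suc (toℕ j)
  dist (leg i j) (leg i′ j′) with i FP.≟ i′
  ... | yes _ = ∣ toℕ j - toℕ j′ ∣
  ... | no  _ = suc (toℕ j) + suc (toℕ j′)

  dist-same : ∀ i (j j′ : Fin (a i)) → dist (leg i j) (leg i j′) ≡ ∣ toℕ j - toℕ j′ ∣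
  dist-same i j j′ with i FP.≟ i
  ... | yes _ = refl
  ... | no ¬e = contradiction refl ¬e

  dist-diff : ∀ {i i′} j j′ → i ≢ i′ → dist (leg i j) (leg i′ j′) ≡ suc (toℕ j) + suc (toℕ j′)
  dist-diff {i} {i′} j j′ ne with i FP.≟ i′
  ... | yes e = contradiction e ne
  ... | no _  = refl

  dist-refl : ∀ u → dist u u ≡ 0
  dist-refl hub       = refl
  dist-refl (leg i j) = trans (dist-same i j j) (m≡n⇒∣m-n∣≡0 {toℕ j} refl)

  dist-step : ∀ {u w} v → u ~ w → dist u v ≤ suc (dist w v)
  dist-step hub (hub-leg i j e) = z≤n
  dist-step (leg i′ j′) (hub-leg i j e) with i FP.≟ i′
  ... | yes _ rewrite e = ≤-refl
  ... | no  _ = m≤n⇒m≤1+n (m≤n+m (suc (toℕ j′)) (suc (toℕ j)))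
  dist-step hub (leg-hub i j e) rewrite e = ≤-refl
  dist-step (leg i′ j′) (leg-hub i j e) with i FP.≟ i′
  ... | yes _ rewrite e = m≤n⇒m≤1+n (n≤1+n _)
  ... | no  _ rewrite e = ≤-refl
  dist-step hub (out i j j′ e) rewrite sym e = m≤n⇒m≤1+n (n≤1+n _)
  dist-step (leg i″ j″) (out i j j′ e) with i FP.≟ i″
  ... | yes _ rewrite sym e = ∣-∣-step (toℕ j) (toℕ j″)
  ... | no  _ rewrite sym e = m≤n⇒m≤1+n (n≤1+n _)
  dist-step hub (inw i j j′ e) rewrite sym e = ≤-refl
  dist-step (leg i″ j″) (inw i j j′ e) with i FP.≟ i″
  ... | yes _ rewrite sym e = ∣-∣-step′ (toℕ j) (toℕ j″)
  ... | no  _ rewrite sym e = ≤-refl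

  dist≤walk : ∀ {u v l} → Walk _~_ u v l → dist u v ≤ l
  dist≤walk {u} here           = ≤-reflexive (dist-refl u)
  dist≤walk {v = v} (step e p) = ≤-trans (dist-step v e) (s≤s (dist≤walk p))

  vertex : ∀ i {p} → p < a i → V
  vertex i p< = leg i (fromℕ< p<)

  dist-vertex : ∀ i j {p} (p< : p < a i) → dist (leg i j) (vertex i p<) ≡ ∣ toℕ j - p ∣
  dist-vertex i j p< = trans (dist-same i j _) (cong (λ q → ∣ toℕ j - q ∣) (toℕ-fromℕ< p<))

  dist-other-vertex : ∀ {i i′} j {p} (p< : p < a i′) → i ≢ i′ →
                      dist (leg i j) (vertex i′ p<) ≡ suc (toℕ j) + suc p
  dist-other-vertex j p< i≢i′ = trans (dist-diff j _ i≢i′) (cong (λ q → suc (toℕ j) + suc q) (toℕ-fromℕ< p<))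

  -- The length `d` is a separate argument tied to the positions by an equation, which makes the
  -- recursion structural.
  walk-outward : ∀ i (j j′ : Fin (a i)) d → toℕ j + d ≡ toℕ j′ → Walk _~_ (leg i j) (leg i j′) d
  walk-outward i j j′ zero e with toℕ-injective {i = j} {j = j′} (trans (sym (+-identityʳ _)) e)
  ... | refl = here
  walk-outward i j j′ (suc d) e =
    step (out i j next (sym next≡)) (walk-outward i next j′ d (trans (cong (_+ d) next≡) e′))
    where
    e′ : suc (toℕ j) + d ≡ toℕ j′
    e′ = trans (sym (+-suc (toℕ j) d)) e
    next< : suc (toℕ j) < a i
    next< = <-≤-trans (s≤s (≤-trans (m≤m+n _ d) (≤-reflexive e′))) (toℕ<n j′)
    next : Fin (a i)
    next = fromℕ< next<
    next≡ : toℕ next ≡ suc (toℕ j)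
    next≡ = toℕ-fromℕ< next<

  walk-from-hub : ∀ i (j : Fin (a i)) → Walk _~_ hub (leg i j) (suc (toℕ j))
  walk-from-hub i j = step (hub-leg i first first≡) (walk-outward i first j (toℕ j) (cong (_+ toℕ j) first≡))
    where
    first< : 0 < a i
    first< = ≤-<-trans z≤n (toℕ<n j)
    first : Fin (a i)
    first = fromℕ< first<
    first≡ : toℕ first ≡ 0
    first≡ = toℕ-fromℕ< first<

  shortest-walk : ∀ u v → Walk _~_ u v (dist u v)
  shortest-walk hub       hub       = here
  shortest-walk hub       (leg i j) = walk-from-hub i j
  shortest-walk (leg i j) hub       = walk-reverse PalmAdj-sym (walk-from-hub i j)
  shortest-walk (leg i j) (leg i′ j′) with i FP.≟ i′
  ... | no _ = walk-++ (walk-reverse PalmAdj-sym (walk-from-hub i j)) (walk-from-hub i′ j′)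
  ... | yes refl with ≤-total (toℕ j) (toℕ j′)
  ...   | inj₁ j≤j′ rewrite m≤n⇒∣m-n∣≡n∸m j≤j′ = walk-outward i j j′ _ (m+[n∸m]≡n j≤j′)
  ...   | inj₂ j′≤j rewrite m≤n⇒∣n-m∣≡n∸m j′≤j =
    walk-reverse PalmAdj-sym (walk-outward i j′ j _ (m+[n∸m]≡n j′≤j))

  module _ {k} {c : V → Fin k} where

    DistToClass-intro : ∀ {i u} v → c v ≡ i → (∀ w → c w ≡ i → dist u v ≤ dist u w) →
                        DistToClass _~_ c i u (dist u v)
    DistToClass-intro {u = u} v cv min =
      (v , cv , shortest-walk u v) , λ w m cw p → ≤-trans (min w cw) (dist≤walk p)

    DistToClass⇒≤dist : ∀ {i u m} → DistToClass _~_ c i u m → ∀ v → c v ≡ i → m ≤ dist u v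
    DistToClass⇒≤dist {u = u} (_ , min) v cv = min v _ cv (shortest-walk u v)

    DistToClass⇒nearest : ∀ {i u m} → DistToClass _~_ c i u m → ∃ λ v → c v ≡ i × dist u v ≡ m
    DistToClass⇒nearest {u = u} ((v , cv , p) , min) =
      v , cv , ≤-antisym (dist≤walk p) (min v _ cv (shortest-walk u v))

    SameCode⇒≤dist : ∀ {i u v m} → SameCode _~_ c u v → DistToClass _~_ c i u m →
                     ∀ w → c w ≡ i → m ≤ dist v w
    SameCode⇒≤dist s d = DistToClass⇒≤dist (proj₁ (s _ _) d)

  neighbour : (∀ i → 1 ≤ a i) → Fin n → V
  neighbour a≥1 i = vertex i (a≥1 i)

  any-vertex? : {P : V → Set} → Decidable P → Dec (∃ P)
  any-vertex? P? with P? hub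
  ... | yes p = yes (hub , p)
  ... | no ¬p with FP.any? (λ i → FP.any? (λ j → P? (leg i j)))
  ...   | yes (i , j , p) = yes (leg i j , p)
  ...   | no ¬q = no λ { (hub , p) → ¬p p ; (leg i j , p) → ¬q (i , j , p) }

  distance-to-class : ∀ {k} (c : V → Fin k) i u →
                      (∃ λ m → DistToClass _~_ c i u m) ⊎ (∀ v → c v ≢ i)
  distance-to-class c i u with any-vertex? (λ v → c v FP.≟ i)
  ... | no none = inj₂ λ v cv → none (v , cv)
  ... | yes (v , cv)
      with least (λ m → any-vertex? (λ w → (c w FP.≟ i) ×-dec (dist u w ≟ m))) (dist u v) (v , cv , refl)
  ...   | m , (w , cw , refl) , min =
    inj₁ (m , DistToClass-intro w cw (λ w′ cw′ → min _ (w′ , cw′ , refl)))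

-- Counting the codes of the hub's neighbours

pigeonhole-∈ : ∀ {A : Set} {n} (xs : List A) (f : Fin n → A) → (∀ i → f i ∈ xs) → length xs < n →
               ∃₂ λ i j → i ≢ j × f i ≡ f j
pigeonhole-∈ xs f f∈ len< with FP.pigeonhole len< (λ i → index (f∈ i))
... | i , j , i<j , eq = i , j , FP.<⇒≢ i<j ,
  trans (lookup-index (f∈ i)) (trans (cong (List.lookup xs) eq) (sym (lookup-index (f∈ j))))

length-cartesianProductWith : ∀ {A B C : Set} (f : A → B → C) xs ys →
  length (cartesianProductWith f xs ys) ≡ length xs * length ys
length-cartesianProductWith f []       ys = refl
length-cartesianProductWith f (x ∷ xs) ys =
  trans (length-++ (map (f x) ys))
        (cong₂ _+_ (length-map (f x) ys) (length-cartesianProductWith f xs ys))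

-- A colour is `own` if it is the hub's, `seen` if it occurs on a neighbour of the hub, and `unseen`
-- otherwise.
data Role : Set where
  own seen unseen : Role

-- Letter ℓ records that a neighbour of the hub lies at distance d + ℓ − 1 from
-- a colour class at distance d from the hub.  At a colour seen on some neighbour
-- (d = 1), ℓ = 0 happens only for the neighbours of that colour; hence words₁,
-- where exactly one seen colour carries 0, against words₀, where none does.
Letter : Set
Letter = Fin 3

-- Letters possible at a colour other than the neighbour's. The hub's own colour has d = 0 and, by
-- properness, distance 1 from every neighbour; a seen colour has d = 1 and distance 1 or 2.
letters : Role → List Letter
letters own    = 2F ∷ []
letters seen   = 1F ∷ 2F ∷ []
letters unseen = allFin 3

words₀ : ∀ {k} → Vec Role k → List (Vec Letter k)
words₀ []      = [] ∷ []
words₀ (ρ ∷ τ) = cartesianProductWith _∷_ (letters ρ) (words₀ τ)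

mutual
  words₁ : ∀ {k} → Vec Role k → List (Vec Letter k)
  words₁ []      = []
  -- Either the head carries the single 0, or it takes an ordinary letter and the 0 comes later.
  words₁ (ρ ∷ τ) = marked ρ τ ++ cartesianProductWith _∷_ (letters ρ) (words₁ τ)

  marked : ∀ {k} → Role → Vec Role k → List (Vec Letter (suc k))
  marked seen τ = cartesianProductWith _∷_ (0F ∷ []) (words₀ τ)
  marked _    τ = []

∈-words₀ : ∀ {k} (τ : Vec Role k) w → (∀ i → lookup w i ∈ letters (lookup τ i)) → w ∈ words₀ τ
∈-words₀ []      []      fits = here refl
∈-words₀ (ρ ∷ τ) (ℓ ∷ w) fits =
  ∈-cartesianProductWith⁺ _∷_ (fits zero) (∈-words₀ τ w (λ i → fits (suc i)))

∈-words₁ : ∀ {k} (τ : Vec Role k) w j → lookup τ j ≡ seen → lookup w j ≡ 0F →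
           (∀ i → i ≢ j → lookup w i ∈ letters (lookup τ i)) → w ∈ words₁ τ
∈-words₁ (.seen ∷ τ) (.0F ∷ w) zero refl refl fits =
  ∈-++⁺ˡ (∈-cartesianProductWith⁺ _∷_ {xs = 0F ∷ []} (here refl) (∈-words₀ τ w (λ i → fits (suc i) λ ())))
∈-words₁ (ρ ∷ τ) (ℓ ∷ w) (suc j) τj wj fits =
  ∈-++⁺ʳ (marked ρ τ) (∈-cartesianProductWith⁺ _∷_ (fits zero λ ())
    (∈-words₁ τ w j τj wj (λ i ne → fits (suc i) (λ e → ne (FP.suc-injective e)))))

#seen : ∀ {k} → Vec Role k → ℕ
#seen []           = 0
#seen (own    ∷ τ) = #seen τ
#seen (seen   ∷ τ) = suc (#seen τ)
#seen (unseen ∷ τ) = #seen τ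

#unseen : ∀ {k} → Vec Role k → ℕ
#unseen []           = 0
#unseen (own    ∷ τ) = #unseen τ
#unseen (seen   ∷ τ) = #unseen τ
#unseen (unseen ∷ τ) = suc (#unseen τ)

#seen+#unseen≤ : ∀ {k} (τ : Vec Role k) → #seen τ + #unseen τ ≤ k
#seen+#unseen≤ []           = z≤n
#seen+#unseen≤ (own    ∷ τ) = m≤n⇒m≤1+n (#seen+#unseen≤ τ)
#seen+#unseen≤ (seen   ∷ τ) = s≤s (#seen+#unseen≤ τ)
#seen+#unseen≤ (unseen ∷ τ) = ≤-trans (≤-reflexive (+-suc (#seen τ) _)) (s≤s (#seen+#unseen≤ τ))

#seen+#unseen< : ∀ {k} (τ : Vec Role k) h → lookup τ h ≡ own → #seen τ + #unseen τ < k
#seen+#unseen< (.own   ∷ τ) zero    refl = s≤s (#seen+#unseen≤ τ)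
#seen+#unseen< (own    ∷ τ) (suc h) e    = m≤n⇒m≤1+n (#seen+#unseen< τ h e)
#seen+#unseen< (seen   ∷ τ) (suc h) e    = s≤s (#seen+#unseen< τ h e)
#seen+#unseen< (unseen ∷ τ) (suc h) e    =
  ≤-trans (≤-reflexive (cong suc (+-suc (#seen τ) _))) (s≤s (#seen+#unseen< τ h e))

length-words₀ : ∀ {k} (τ : Vec Role k) → length (words₀ τ) ≡ 2 ^ #seen τ * 3 ^ #unseen τ
length-words₀ []      = refl
length-words₀ (ρ ∷ τ) =
  trans (length-cartesianProductWith _∷_ (letters ρ) (words₀ τ))
        (trans (cong (length (letters ρ) *_) (length-words₀ τ)) (grow ρ))
  where
  arith : ∀ x y → 3 * (x * y) ≡ x * (3 * y)
  arith = solve-∀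
  grow : ∀ ρ → length (letters ρ) * (2 ^ #seen τ * 3 ^ #unseen τ) ≡ 2 ^ #seen (ρ ∷ τ) * 3 ^ #unseen (ρ ∷ τ)
  grow own    = *-identityˡ _
  grow seen   = sym (*-assoc 2 (2 ^ #seen τ) _)
  grow unseen = arith (2 ^ #seen τ) (3 ^ #unseen τ)

-- The 0 is placed at one of the s seen colours, and each of the other s - 1 has 2 letters: the
-- count is s 2^(s-1) 3^r. Doubling removes the exponent s - 1, so that s = 0 needs no exception.
length-words₁ : ∀ {k} (τ : Vec Role k) →
                2 * length (words₁ τ) ≡ #seen τ * (2 ^ #seen τ * 3 ^ #unseen τ)
length-words₁ []      = refl
length-words₁ (ρ ∷ τ) = trans (cong (2 *_) (trans (length-++ (marked ρ τ))
    (cong (length (marked ρ τ) +_) (length-cartesianProductWith _∷_ (letters ρ) (words₁ τ))))) (grow ρ)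
  where
  s = #seen τ
  x = 2 ^ #seen τ
  y = 3 ^ #unseen τ
  arith-seen : ∀ x y l → 2 * (1 * (x * y) + 2 * l) ≡ 2 * (x * y) + 2 * (2 * l)
  arith-seen = solve-∀
  arith-seen′ : ∀ s x y → 2 * (x * y) + 2 * (s * (x * y)) ≡ suc s * (2 * x * y)
  arith-seen′ = solve-∀
  arith-unseen : ∀ l → 2 * (3 * l) ≡ 3 * (2 * l)
  arith-unseen = solve-∀
  arith-unseen′ : ∀ s x y → 3 * (s * (x * y)) ≡ s * (x * (3 * y))
  arith-unseen′ = solve-∀
  grow : ∀ ρ → 2 * (length (marked ρ τ) + length (letters ρ) * length (words₁ τ)) ≡
               #seen (ρ ∷ τ) * (2 ^ #seen (ρ ∷ τ) * 3 ^ #unseen (ρ ∷ τ))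
  grow own = trans (cong (2 *_) (*-identityˡ (length (words₁ τ)))) (length-words₁ τ)
  grow seen = begin
    2 * (length (marked seen τ) + 2 * length (words₁ τ))
      ≡⟨ cong (λ z → 2 * (z + 2 * length (words₁ τ))) (length-cartesianProductWith _∷_ (0F ∷ []) (words₀ τ)) ⟩
    2 * (1 * length (words₀ τ) + 2 * length (words₁ τ))
      ≡⟨ cong (λ z → 2 * (1 * z + 2 * length (words₁ τ))) (length-words₀ τ) ⟩
    2 * (1 * (x * y) + 2 * length (words₁ τ))
      ≡⟨ arith-seen x y (length (words₁ τ)) ⟩
    2 * (x * y) + 2 * (2 * length (words₁ τ))
      ≡⟨ cong (λ z → 2 * (x * y) + 2 * z) (length-words₁ τ) ⟩
    2 * (x * y) + 2 * (s * (x * y))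
      ≡⟨ arith-seen′ s x y ⟩
    suc s * (2 * x * y) ∎
    where open ≡-Reasoning
  grow unseen = trans (arith-unseen (length (words₁ τ)))
    (trans (cong (3 *_) (length-words₁ τ)) (arith-unseen′ s x y))

-- Equality holds at s = 2 and s = 3.
s2^s-bound : ∀ s → 9 * (s * 2 ^ s) ≤ 8 * 3 ^ s
s2^s-bound 0 = z≤n
s2^s-bound 1 = m≤m+n 18 6
s2^s-bound 2 = ≤-refl
s2^s-bound (suc s@(suc (suc r))) = begin
  9 * (suc s * (2 * 2 ^ s))   ≡⟨ lhs s (2 ^ s) ⟩
  -- From s to s + 1 the left side of the bound grows by the factor 2(s + 1)/s, at most 3 once s ≥
  -- 2; the slack is `r` = s - 2.
  9 * 2 ^ s * (2 * suc s)     ≤⟨ *-monoʳ-≤ (9 * 2 ^ s) (≤-trans (m≤m+n (2 * suc s) r) (≤-reflexive (2s+2≤3s r))) ⟩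
  9 * 2 ^ s * (3 * s)         ≡⟨ rhs s (2 ^ s) ⟩
  3 * (9 * (s * 2 ^ s))       ≤⟨ *-monoʳ-≤ 3 (s2^s-bound s) ⟩
  3 * (8 * 3 ^ s)             ≡⟨ *-comm-middle (3 ^ s) ⟩
  8 * (3 * 3 ^ s)             ∎
  where
  open ≤-Reasoning
  lhs : ∀ s x → 9 * (suc s * (2 * x)) ≡ 9 * x * (2 * suc s)
  lhs = solve-∀
  rhs : ∀ s x → 9 * x * (3 * s) ≡ 3 * (9 * (s * x))
  rhs = solve-∀
  2s+2≤3s : ∀ r → 2 * suc (suc (suc r)) + r ≡ 3 * suc (suc r)
  2s+2≤3s = solve-∀
  *-comm-middle : ∀ x → 3 * (8 * x) ≡ 8 * (3 * x)
  *-comm-middle = solve-∀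

-- The hub's own colour is neither seen nor unseen, so s + r ≤ k. The factor 9 expresses the bound
-- 4·3^(k-2) without a negative exponent when k < 2.
length-words₁-bound : ∀ {k} (τ : Vec Role (suc k)) h → lookup τ h ≡ own →
                      9 * length (words₁ τ) ≤ 4 * 3 ^ k
length-words₁-bound {k} τ h own-h = *-cancelˡ-≤ 2 (begin
  2 * (9 * length (words₁ τ))    ≡⟨ swap₂₉ (length (words₁ τ)) ⟩
  9 * (2 * length (words₁ τ))    ≡⟨ cong (9 *_) (length-words₁ τ) ⟩
  9 * (s * (2 ^ s * 3 ^ r))      ≡⟨ regroup s (2 ^ s) (3 ^ r) ⟩
  9 * (s * 2 ^ s) * 3 ^ r        ≤⟨ *-monoˡ-≤ (3 ^ r) (s2^s-bound s) ⟩
  8 * 3 ^ s * 3 ^ r              ≡⟨ *-assoc 8 (3 ^ s) (3 ^ r) ⟩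
  8 * (3 ^ s * 3 ^ r)            ≡⟨ cong (8 *_) (^-distribˡ-+-* 3 s r) ⟨
  8 * 3 ^ (s + r)                ≤⟨ *-monoʳ-≤ 8 (^-monoʳ-≤ 3 (s≤s⁻¹ (#seen+#unseen< τ h own-h))) ⟩
  8 * 3 ^ k                      ≡⟨ *-assoc 2 4 (3 ^ k) ⟩
  2 * (4 * 3 ^ k)                ∎)
  where
  open ≤-Reasoning
  s = #seen τ
  r = #unseen τ
  swap₂₉ : ∀ l → 2 * (9 * l) ≡ 9 * (2 * l)
  swap₂₉ = solve-∀
  regroup : ∀ s x y → 9 * (s * (x * y)) ≡ 9 * (s * x) * y
  regroup = solve-∀

-- The words of the hub's neighbours in a given colouring

module _ {n : ℕ} {a : Fin n → ℕ} (a≥1 : ∀ i → 1 ≤ a i) {k : ℕ} {c : PalmV n a → Fin k} where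

  private
    _~_ = PalmAdj n a
    D = DistToClass _~_ c
    first = neighbour a≥1

  first-injective : ∀ {i j} → first i ≡ first j → i ≡ j
  first-injective refl = refl

  hub~first : ∀ i → hub ~ first i
  hub~first i = hub-leg i _ (toℕ-fromℕ< (a≥1 i))

  first~hub : ∀ i → first i ~ hub
  first~hub i = PalmAdj-sym (hub~first i)

  D-own : ∀ u → D (c u) u 0
  D-own u = (u , refl , here) , λ _ _ _ _ → z≤n

  D-zero : ∀ {i u} → D i u 0 → c u ≡ i
  D-zero ((_ , cu , here) , _) = cu

  -- Vacuous for a colour without vertices; the `suc` replaces the -1 of d + ℓ - 1.
  Describes : Fin k → Fin n → Letter → Set
  Describes i m ℓ = ∀ {d e} → D i hub d → D i (first m) e → suc e ≡ d + toℕ ℓ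

  letter : ∀ i m → Σ Letter (Describes i m)
  letter i m with distance-to-class c i hub | distance-to-class c i (first m)
  -- The default `2F` is harmless: a colour without vertices is `unseen`, where every letter is
  -- allowed.
  ... | inj₂ none | _ = 2F , λ where ((v , cv , _) , _) _ → contradiction cv (none v)
  ... | inj₁ _ | inj₂ none = 2F , λ where _ ((v , cv , _) , _) → contradiction cv (none v)
  ... | inj₁ (d , Dd) | inj₁ (e , De) = fromℕ< 1+e∸d<3 , spec
    where
    d≤1+e : d ≤ suc e
    d≤1+e = DistToClass-step (hub~first m) Dd De
    1+e∸d<3 : suc e ∸ d < 3
    1+e∸d<3 = s≤s (m≤n+o⇒m∸n≤o (suc e) d
      (≤-trans (s≤s (DistToClass-step (first~hub m) De Dd)) (≤-reflexive (+-comm 2 d))))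
    spec : ∀ {d′ e′} → D i hub d′ → D i (first m) e′ → suc e′ ≡ d′ + toℕ (fromℕ< 1+e∸d<3)
    spec Dd′ De′ rewrite DistToClass-unique Dd′ Dd | DistToClass-unique De′ De | toℕ-fromℕ< 1+e∸d<3 =
      sym (m+[n∸m]≡n d≤1+e)

  word : Fin n → Vec Letter k
  word m = tabulate λ i → proj₁ (letter i m)

  word≡⇒letter≡ : ∀ {m m′} → word m ≡ word m′ → ∀ i → proj₁ (letter i m) ≡ proj₁ (letter i m′)
  word≡⇒letter≡ {m} {m′} eq i =
    trans (sym (lookup∘tabulate _ i)) (trans (cong (λ w → lookup w i) eq) (lookup∘tabulate _ i))

  -- The hub's distances are common to all neighbours, so the letters recover every distance from a
  -- neighbour.
  word≡⇒D : ∀ {m m′} → word m ≡ word m′ → ∀ i e → D i (first m) e → D i (first m′) e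
  word≡⇒D {m} {m′} eq i e De@((v , cv , _) , _)
      with distance-to-class c i hub | distance-to-class c i (first m′)
  ... | inj₂ none | _ = contradiction cv (none v)
  ... | inj₁ _ | inj₂ none = contradiction cv (none v)
  ... | inj₁ (d , Dd) | inj₁ (e′ , De′) = subst (D i (first m′)) (suc-injective e′≡e) De′
    where
    e′≡e : suc e′ ≡ suc e
    e′≡e = trans (proj₂ (letter i m′) Dd De′)
             (trans (cong (λ ℓ → d + toℕ ℓ) (sym (word≡⇒letter≡ eq i))) (sym (proj₂ (letter i m) Dd De)))

  role : Fin k → Role
  role i with c hub FP.≟ i | FP.any? (λ m → c (first m) FP.≟ i)
  ... | yes _ | _     = own
  ... | no _  | yes _ = seen
  ... | no _  | no _  = unseen

  roles : Vec Role k
  roles = tabulate role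

  module _ (proper : Proper _~_ k c) where

    -- Here d = 0, and e ≥ 1 by properness, so 1 + e = ℓ leaves only 2.
    letter-own : ∀ m ℓ → Describes (c hub) m ℓ → ℓ ≡ 2F
    letter-own m ℓ sp with distance-to-class c (c hub) (first m)
    ... | inj₂ none        = contradiction refl (none hub)
    ... | inj₁ (zero , De) = contradiction (sym (D-zero De)) (proper hub (first m) (hub~first m))
    letter-own m 0F sp | inj₁ (suc e , De) with () ← sp (D-own hub) De
    letter-own m 1F sp | inj₁ (suc e , De) with () ← sp (D-own hub) De
    letter-own m 2F sp | inj₁ (suc e , De) = refl

    -- Here e = 0, and d ≥ 1 by properness, so 1 = d + ℓ leaves only 0.
    letter-mine : ∀ m ℓ → Describes (c (first m)) m ℓ → ℓ ≡ 0F
    letter-mine m ℓ sp with distance-to-class c (c (first m)) hub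
    ... | inj₂ none        = contradiction refl (none (first m))
    ... | inj₁ (zero , Dd) = contradiction (D-zero Dd) (proper hub (first m) (hub~first m))
    letter-mine m 0F      sp | inj₁ (suc d , Dd) = refl
    letter-mine m (suc ℓ) sp | inj₁ (suc d , Dd)
      with () ← trans (suc-injective (sp Dd (D-own (first m)))) (+-suc d _)

    -- Colour `i` on neighbour `m′` gives d ≤ 1, while e ≥ 1 because `m` has another colour; the
    -- letter 0 would require 1 + e = d.
    letter-other : ∀ {m m′ i} → c (first m′) ≡ i → c (first m) ≢ i →
                   ∀ ℓ → Describes i m ℓ → ℓ ∈ letters seen
    letter-other _ _ 1F _ = here refl
    letter-other _ _ 2F _ = there (here refl)
    letter-other {m} {m′} {i} cm′ cm≢ 0F sp with distance-to-class c i hub | distance-to-class c i (first m)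
    ... | inj₂ none     | _                 = contradiction cm′ (none (first m′))
    ... | inj₁ _        | inj₂ none         = contradiction cm′ (none (first m′))
    ... | inj₁ _        | inj₁ (zero , De)  = contradiction (D-zero De) cm≢
    ... | inj₁ (d , Dd) | inj₁ (suc e , De) = contradiction 2+e≤1 λ where (s≤s ())
      where
      d≤1 : d ≤ 1
      d≤1 = DistToClass-step (hub~first m′) Dd (subst (λ i → D i (first m′) 0) cm′ (D-own (first m′)))
      2+e≤1 : suc (suc e) ≤ 1
      2+e≤1 = ≤-trans (≤-reflexive (trans (sp Dd De) (+-identityʳ d))) d≤1

    role-own : role (c hub) ≡ own
    role-own with c hub FP.≟ c hub
    ... | yes _ = refl
    ... | no ¬e = contradiction refl ¬e

    role-first : ∀ m → role (c (first m)) ≡ seen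
    role-first m with c hub FP.≟ c (first m) | FP.any? (λ m′ → c (first m′) FP.≟ c (first m))
    ... | yes e | _     = contradiction e (proper hub (first m) (hub~first m))
    ... | no _  | yes _ = refl
    ... | no _  | no ¬e = contradiction (m , refl) ¬e

    letter-fits : ∀ m i → c (first m) ≢ i → ∀ ℓ → Describes i m ℓ → ℓ ∈ letters (role i)
    letter-fits m i ne ℓ sp with c hub FP.≟ i | FP.any? (λ m → c (first m) FP.≟ i)
    ... | yes refl | _              = here (letter-own m ℓ sp)
    ... | no _     | yes (m′ , cm′) = letter-other cm′ ne ℓ sp
    ... | no _     | no _           = ∈-allFin _

    word∈words₁ : ∀ m → word m ∈ words₁ roles
    word∈words₁ m = ∈-words₁ roles (word m) (c (first m))
      (trans (lookup∘tabulate role (c (first m))) (role-first m))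
      (trans (lookup∘tabulate (λ i → proj₁ (letter i m)) (c (first m))) (letter-mine m _ (proj₂ (letter (c (first m)) m))))
      λ i ne → subst₂ (λ ℓ ρ → ℓ ∈ letters ρ) (sym (lookup∘tabulate _ i)) (sym (lookup∘tabulate _ i))
                 (letter-fits m i (λ e → ne (sym e)) _ (proj₂ (letter i m)))

  locating⇒n≤words : Locating _~_ k c → n ≤ length (words₁ roles)
  locating⇒n≤words (proper , inj) = ≮⇒≥ λ len< →
    let i , j , i≢j , eq = pigeonhole-∈ (words₁ roles) word (word∈words₁ proper) len<
    in i≢j (first-injective (inj (first i) (first j) λ x m → word≡⇒D eq x m , word≡⇒D (sym eq) x m))

-- The lower bound for the number of colours

locating⇒9n≤4·3^k : ∀ {n} {a : Fin n → ℕ} → (∀ i → 1 ≤ a i) → ∀ {k} (c : PalmV n a → Fin (suc k)) →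
                    Locating (PalmAdj n a) (suc k) c → 9 * n ≤ 4 * 3 ^ k
locating⇒9n≤4·3^k a≥1 c loc@(proper , _) =
  ≤-trans (*-monoʳ-≤ 9 (locating⇒n≤words a≥1 loc))
          (length-words₁-bound (roles a≥1 {c = c}) (c hub)
            (trans (lookup∘tabulate (role a≥1 {c = c}) (c hub)) (role-own a≥1 proper)))

-- At most t + 2 colours would give 3n ≤ 4·3^t. For t = 0 this contradicts n ≥ 2; for t = s + 1 it
-- gives n ≤ 4·3^s, against the minimality of t.
no-locating-colouring : ∀ {n} {a : Fin n → ℕ} → 2 ≤ n → (∀ i → 1 ≤ a i) →
                        ∀ t → (∀ s → s < t → ¬ (n ≤ 4 * 3 ^ s)) →
                        ∀ k → k < t + 3 → (c : PalmV n a → Fin k) → ¬ Locating (PalmAdj n a) k c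
no-locating-colouring 2≤n a≥1 t minimal zero k< c loc with () ← c hub
no-locating-colouring {n} 2≤n a≥1 t minimal (suc k) k< c loc = excluded t minimal 3n≤4·3^t
  where
  open ≤-Reasoning
  swap₃₄ : ∀ x → 4 * (3 * x) ≡ 3 * (4 * x)
  swap₃₄ = solve-∀
  3n≤4·3^t : 3 * n ≤ 4 * 3 ^ t
  3n≤4·3^t = *-cancelˡ-≤ 3 (begin
    3 * (3 * n)      ≡⟨ *-assoc 3 3 n ⟨
    9 * n            ≤⟨ locating⇒9n≤4·3^k a≥1 c loc ⟩
    4 * 3 ^ k        ≤⟨ *-monoʳ-≤ 4 (^-monoʳ-≤ 3 (s≤s⁻¹ (s≤s⁻¹ (≤-trans k< (≤-reflexive (+-comm t 3)))))) ⟩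
    4 * (3 * 3 ^ t)  ≡⟨ swap₃₄ (3 ^ t) ⟩
    3 * (4 * 3 ^ t)  ∎)
  excluded : ∀ t → (∀ s → s < t → ¬ (n ≤ 4 * 3 ^ s)) → ¬ (3 * n ≤ 4 * 3 ^ t)
  excluded zero    minimal le = <⇒≱ (m≤m+n 5 1) (≤-trans (*-monoʳ-≤ 3 2≤n) le)
  excluded (suc s) minimal le = minimal s (n<1+n s) (*-cancelˡ-≤ 3 (begin
    3 * n            ≤⟨ le ⟩
    4 * (3 * 3 ^ s)  ≡⟨ swap₃₄ (3 ^ s) ⟩
    3 * (4 * 3 ^ s)  ∎))

-- Ternary digits and the colouring of a leg

digit : ℕ → ℕ → Fin 3
digit q zero    = q mod 3
digit q (suc k) = digit (q / 3) k

mod-≡⇒%-≡ : ∀ m n d .{{_ : NonZero d}} → m mod d ≡ n mod d → m % d ≡ n % d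
mod-≡⇒%-≡ m n d e = trans (sym (toℕ-fromℕ< (m%n<n m d))) (trans (cong toℕ e) (toℕ-fromℕ< (m%n<n n d)))

/-%-injective : ∀ m n d .{{_ : NonZero d}} → m % d ≡ n % d → m / d ≡ n / d → m ≡ n
/-%-injective m n d e f =
  trans (m≡m%n+[m/n]*n m d) (trans (cong₂ (λ x y → x + y * d) e f) (sym (m≡m%n+[m/n]*n n d)))

digits-injective : ∀ t q r → q < 3 ^ t → r < 3 ^ t → (∀ k → k < t → digit q k ≡ digit r k) → q ≡ r
digits-injective zero    q r q< r< eq = trans (n<1⇒n≡0 q<) (sym (n<1⇒n≡0 r<))
digits-injective (suc t) q r q< r< eq =
  /-%-injective q r 3 (mod-≡⇒%-≡ q r 3 (eq 0 z<s))
    (digits-injective t (q / 3) (r / 3) (quotient< q<) (quotient< r<) (λ k k< → eq (suc k) (s<s k<)))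
  where
  quotient< : ∀ {q} → q < 3 ^ suc t → q / 3 < 3 ^ t
  quotient< q< = m<n*o⇒m/o<n (<-≤-trans q< (≤-reflexive (*-comm 3 (3 ^ t))))

-- Serves twice: a leg with a nonzero k-th digit has an index large enough for the length
-- hypotheses, and no digit from place t on is nonzero.
digit⇒≤ : ∀ q k (e : Fin 2) → digit q k ≡ suc e → suc (toℕ e) * 3 ^ k ≤ q
digit⇒≤ q zero e eq = begin
  suc (toℕ e) * 1  ≡⟨ *-identityʳ (suc (toℕ e)) ⟩
  suc (toℕ e)      ≡⟨ trans (cong toℕ (sym eq)) (toℕ-fromℕ< (m%n<n q 3)) ⟩
  q % 3            ≤⟨ m%n≤m q 3 ⟩
  q                ∎
  where open ≤-Reasoning
digit⇒≤ q (suc k) e eq = begin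
  suc (toℕ e) * (3 * 3 ^ k)  ≡⟨ swap₃ (suc (toℕ e)) (3 ^ k) ⟩
  suc (toℕ e) * 3 ^ k * 3    ≤⟨ *-monoˡ-≤ 3 (digit⇒≤ (q / 3) k e eq) ⟩
  q / 3 * 3                  ≤⟨ m/n*n≤m q 3 ⟩
  q                          ∎
  where
  open ≤-Reasoning
  swap₃ : ∀ x y → x * (3 * y) ≡ x * y * 3
  swap₃ = solve-∀

-- Makes leg 4·3^k carry colour k + 3, at the earlier of its two possible places.
digit-3^ : ∀ k → digit (3 ^ k) k ≡ 1F
digit-3^ zero    = refl
digit-3^ (suc k) =
  trans (cong (λ q → digit q k) (trans (cong (_/ 3) (*-comm 3 (3 ^ k))) (m*n/n≡m (3 ^ k) 3))) (digit-3^ k)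

parity-∣-∣ : ∀ m n → parity ∣ m - n ∣ ≡ parity m ℙ.+ parity n
parity-∣-∣ zero    n       = refl
parity-∣-∣ (suc m) zero    = sym (ℙ.+-identityʳ _)
parity-∣-∣ (suc m) (suc n) = trans (parity-∣-∣ m n) (shift m n)
  where
  cancel : ∀ p q → p ℙ.⁻¹ ℙ.+ q ℙ.⁻¹ ≡ p ℙ.+ q
  cancel 0ℙ 0ℙ = refl
  cancel 0ℙ 1ℙ = refl
  cancel 1ℙ 0ℙ = refl
  cancel 1ℙ 1ℙ = refl
  shift : ∀ m n → parity m ℙ.+ parity n ≡ parity (suc m) ℙ.+ parity (suc n)
  shift m n rewrite sym (ℙ.suc-homo-⁻¹ m) | sym (ℙ.suc-homo-⁻¹ n) = cancel (parity (suc m)) (parity (suc n))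

-- Since |m - n| has the parity of m + n, the summand `m` cancels.
∣-∣≡⇒parity≡ : ∀ m n o → ∣ m - n ∣ ≡ ∣ m - o ∣ → parity n ≡ parity o
∣-∣≡⇒parity≡ m n o e = ℙ.+-cancelˡ-≡ (parity m) _ _
  (trans (sym (parity-∣-∣ m n)) (trans (cong parity e) (parity-∣-∣ m o)))

pick : Fin 3 → Fin 2 → ℕ → ℕ → ℕ
pick d e s x = if does (d FP.≟ suc e) then s else x

-- Positions along a leg are counted from 0 at the neighbour of the hub.  Position 2k + e + 2
-- carries colour k + 3 when the k-th ternary digit of q is e + 1, for e ∈ {0, 1}.
tailColour : (Parity → ℕ) → ℕ → ℕ → ℕ → ℕ
tailColour f s q 0             = pick (q mod 3) 0F s (f 0ℙ)
tailColour f s q 1             = pick (q mod 3) 1F s (f 1ℙ)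
tailColour f s q (suc (suc r)) = tailColour f (suc s) (q / 3) r

legColour : (Parity → ℕ) → ℕ → ℕ → ℕ
legColour f q 0             = f 0ℙ
legColour f q 1             = f 1ℙ
legColour f q (suc (suc r)) = tailColour f 3 q r

place : ℕ → Fin 2 → ℕ
place k e = 2 + (k * 2 + toℕ e)

tailColour-special : ∀ f s q k e → digit q k ≡ suc e → tailColour f s q (k * 2 + toℕ e) ≡ s + k
tailColour-special f s q zero    0F eq rewrite eq = sym (+-identityʳ s)
tailColour-special f s q zero    1F eq rewrite eq = sym (+-identityʳ s)
tailColour-special f s q (suc k) e  eq =
  trans (tailColour-special f (suc s) (q / 3) k e eq) (sym (+-suc s k))

legColour-special : ∀ f q k e → digit q k ≡ suc e → legColour f q (place k e) ≡ 3 + k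
legColour-special f q = tailColour-special f 3 q

data TailView (f : Parity → ℕ) (s q r : ℕ) : Set where
  special : ∀ k e → digit q k ≡ suc e → r ≡ k * 2 + toℕ e → tailColour f s q r ≡ s + k → TailView f s q r
  filling : tailColour f s q r ≡ f (parity r) → TailView f s q r

tailView : ∀ f s q r → TailView f s q r
tailView f s q 0 with (q mod 3) FP.≟ 1F in eq
... | yes e = special 0 0F e refl (trans (cong (λ d → if does d then s else f 0ℙ) eq) (sym (+-identityʳ s)))
... | no _  = filling (cong (λ d → if does d then s else f 0ℙ) eq)
tailView f s q 1 with (q mod 3) FP.≟ 2F in eq
... | yes e = special 0 1F e refl (trans (cong (λ d → if does d then s else f 1ℙ) eq) (sym (+-identityʳ s)))
... | no _  = filling (cong (λ d → if does d then s else f 1ℙ) eq)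
tailView f s q (suc (suc r)) with tailView f (suc s) (q / 3) r
... | special k e d≡ r≡ c≡ = special (suc k) e d≡ (cong (2 +_) r≡) (trans c≡ (sym (+-suc s k)))
... | filling c≡ = filling c≡

data LegView (f : Parity → ℕ) (q j : ℕ) : Set where
  special : ∀ k e → digit q k ≡ suc e → j ≡ place k e → legColour f q j ≡ 3 + k → LegView f q j
  filling : legColour f q j ≡ f (parity j) → LegView f q j

legView : ∀ f q j → LegView f q j
legView f q 0 = filling refl
legView f q 1 = filling refl
legView f q (suc (suc r)) with tailView f 3 q r
... | special k e d≡ r≡ c≡ = special k e d≡ (cong (2 +_) r≡) c≡
... | filling c≡ = filling c≡

-- On legs with index ≡ b mod 4, filler b lists the two alternating colours and missing b is the one
-- of 0, 1, 2 that does not occur.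
filler : Fin 4 → Parity → ℕ
filler 0F 0ℙ = 1
filler 0F 1ℙ = 0
filler 1F 0ℙ = 2
filler 1F 1ℙ = 0
filler 2F 0ℙ = 1
filler 2F 1ℙ = 2
filler 3F 0ℙ = 2
filler 3F 1ℙ = 1

missing : Fin 4 → ℕ
missing 0F = 2
missing 1F = 1
missing 2F = 0
missing 3F = 0

filler<3 : ∀ b p → filler b p < 3
filler<3 0F 0ℙ = s≤s (s≤s z≤n)
filler<3 0F 1ℙ = s≤s z≤n
filler<3 1F 0ℙ = s≤s (s≤s (s≤s z≤n))
filler<3 1F 1ℙ = s≤s z≤n
filler<3 2F 0ℙ = s≤s (s≤s z≤n)
filler<3 2F 1ℙ = s≤s (s≤s (s≤s z≤n))
filler<3 3F 0ℙ = s≤s (s≤s (s≤s z≤n))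
filler<3 3F 1ℙ = s≤s (s≤s z≤n)

missing<3 : ∀ b → missing b < 3
missing<3 0F = s≤s (s≤s (s≤s z≤n))
missing<3 1F = s≤s (s≤s z≤n)
missing<3 2F = s≤s z≤n
missing<3 3F = s≤s z≤n

filler≢missing : ∀ b p → filler b p ≢ missing b
filler≢missing 0F 0ℙ ()
filler≢missing 0F 1ℙ ()
filler≢missing 1F 0ℙ ()
filler≢missing 1F 1ℙ ()
filler≢missing 2F 0ℙ ()
filler≢missing 2F 1ℙ ()
filler≢missing 3F 0ℙ ()
filler≢missing 3F 1ℙ ()

filler-alternates : ∀ b p → filler b p ≢ filler b (p ℙ.⁻¹)
filler-alternates 0F 0ℙ ()
filler-alternates 0F 1ℙ ()
filler-alternates 1F 0ℙ ()
filler-alternates 1F 1ℙ ()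
filler-alternates 2F 0ℙ ()
filler-alternates 2F 1ℙ ()
filler-alternates 3F 0ℙ ()
filler-alternates 3F 1ℙ ()

filler-first≢0 : ∀ b → filler b 0ℙ ≢ 0
filler-first≢0 0F ()
filler-first≢0 1F ()
filler-first≢0 2F ()
filler-first≢0 3F ()

3+k≢small : ∀ {x k} → x < 3 → x ≢ 3 + k
3+k≢small x<3 refl = <⇒≱ x<3 (m≤m+n 3 _)

legColour≢missing : ∀ b q j → legColour (filler b) q j ≢ missing b
legColour≢missing b q j e with legView (filler b) q j
... | special k _ _ _ c≡ = 3+k≢small (missing<3 b) (trans (sym e) c≡)
... | filling c≡ = filler≢missing b (parity j) (trans (sym c≡) e)

-- Fillers alternate with parity and special colours are at least 3, so only two special neighbours
-- could clash; they would share k, hence the digit, hence the position.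
legColour-alternates : ∀ b q j → legColour (filler b) q j ≢ legColour (filler b) q (suc j)
legColour-alternates b q j e with legView (filler b) q j | legView (filler b) q (suc j)
... | filling c≡ | filling c′≡ = filler-alternates b (parity j)
  (trans (sym c≡) (trans e (trans c′≡ (cong (filler b) (trans (sym (ℙ.⁻¹-involutive _)) (cong ℙ._⁻¹ (ℙ.suc-homo-⁻¹ j)))))))
... | filling c≡ | special k _ _ _ c′≡ =
  3+k≢small (filler<3 b (parity j)) (trans (sym c≡) (trans e c′≡))
... | special k _ _ _ c≡ | filling c′≡ =
  3+k≢small (filler<3 b (parity (suc j))) (trans (sym c′≡) (trans (sym e) c≡))
... | special k d d≡ j≡ c≡ | special k′ d′ d′≡ j′≡ c′≡
    with refl ← +-cancelˡ-≡ 3 k k′ (trans (sym c≡) (trans e c′≡))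
    with refl ← FP.suc-injective (trans (sym d≡) d′≡) = 1+n≢n (trans j′≡ (sym j≡))

legColour≡3+k : ∀ b q j k → legColour (filler b) q j ≡ 3 + k → ∃ λ e → digit q k ≡ suc e × j ≡ place k e
legColour≡3+k b q j k eq with legView (filler b) q j
... | filling c≡ = contradiction (trans (sym c≡) eq) (3+k≢small (filler<3 b (parity j)))
... | special k′ e d≡ j≡ c≡ with refl ← +-cancelˡ-≡ 3 k′ k (trans (sym c≡) eq) = e , d≡ , j≡

legColour<3 : ∀ b q j {x} → x < 3 → legColour (filler b) q j ≡ x → filler b (parity j) ≡ x
legColour<3 b q j x<3 eq with legView (filler b) q j
... | filling c≡ = trans (sym c≡) eq
... | special k _ _ _ c≡ = contradiction (trans (sym eq) c≡) (3+k≢small x<3)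

-- Distance to colour k + 3 from position p of a leg whose k-th digit is the last argument.
digitDist : ℕ → ℕ → Fin 3 → ℕ
digitDist p k 0F      = suc p + (3 + k * 2)
digitDist p k (suc e) = ∣ p - place k e ∣

place≤ : ∀ k e → place k e ≤ 3 + k * 2
place≤ k e = ≤-trans (+-monoʳ-≤ 2 (+-monoʳ-≤ (k * 2) (s≤s⁻¹ (toℕ<n e)))) (≤-reflexive (cong (2 +_) (+-comm (k * 2) 1)))

≤1+place : ∀ k e → 3 + k * 2 ≤ suc (place k e)
≤1+place k e = +-monoʳ-≤ 3 (m≤m+n (k * 2) (toℕ e))

-- The right side is the length of the path through the hub to the earlier place of colour k + 3 on
-- another leg.
∣-place∣< : ∀ p k e → ∣ p - place k e ∣ < suc p + (3 + k * 2)
∣-place∣< p k e = s≤s (≤-trans (∣m-n∣≤m+n p (place k e)) (+-monoʳ-≤ p (place≤ k e)))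

place-parity-injective : ∀ k e e′ → parity (place k e) ≡ parity (place k e′) → e ≡ e′
place-parity-injective zero    0F 0F _  = refl
place-parity-injective zero    0F 1F ()
place-parity-injective zero    1F 0F ()
place-parity-injective zero    1F 1F _  = refl
place-parity-injective (suc k) e  e′ eq = place-parity-injective k e e′ eq

-- Digit 0 is separated by the detour through the hub. Digits 1 and 2 mark adjacent places, whose
-- distances from `p` have opposite parity.
digitDist-injective : ∀ p k d d′ → digitDist p k d ≡ digitDist p k d′ → d ≡ d′
digitDist-injective p k 0F      0F       eq = refl
digitDist-injective p k 0F      (suc e)  eq = contradiction (sym eq) (<⇒≢ (∣-place∣< p k e))
digitDist-injective p k (suc e) 0F       eq = contradiction eq (<⇒≢ (∣-place∣< p k e))
digitDist-injective p k (suc e) (suc e′) eq =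
  cong suc (place-parity-injective k e e′ (∣-∣≡⇒parity≡ p (place k e) (place k e′) eq))

-- The locating colouring

module _ {n : ℕ} (2≤n : 2 ≤ n) {a : Fin n → ℕ}
  (a≥1 : ∀ i → 1 ≤ a i)
  (mono : ∀ i j → i F.≤ j → a i ≤ a j)
  (a₃≥2 : (p : 2 < n) → 2 ≤ at a 2 p)
  (long : ∀ k → 4 * 3 ^ k ≤ n →
    ((p : 4 * 3 ^ k < n) → 2 * k + 3 ≤ at a (4 * 3 ^ k) p) ×
    ((p : 8 * 3 ^ k < n) → 2 * k + 4 ≤ at a (8 * 3 ^ k) p))
  {t : ℕ} (n≤4·3^t : n ≤ 4 * 3 ^ t) (minimal : ∀ s → s < t → ¬ (n ≤ 4 * 3 ^ s)) where

  private
    V = PalmV n a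
    _~_ = PalmAdj n a
    first = neighbour a≥1

  base : Fin n → Fin 4
  base i = toℕ i mod 4

  quotient : Fin n → ℕ
  quotient i = toℕ i / 4

  quotient< : ∀ i → quotient i < 3 ^ t
  quotient< i = m<n*o⇒m/o<n (<-≤-trans (toℕ<n i) (≤-trans n≤4·3^t (≤-reflexive (*-comm 4 (3 ^ t)))))

  at≤ : ∀ m (p : m < n) i → m ≤ toℕ i → at a m p ≤ a i
  at≤ m p i m≤i = mono (fromℕ< p) i (≤-trans (≤-reflexive (toℕ-fromℕ< p)) m≤i)

  -- Legs of base 2 or 3 must show both their fillers. Their index is at least 2, so monotonicity
  -- passes on the bound for the third leg.
  base≥2⇒long : ∀ i → 2 ≤ toℕ (base i) → 2 ≤ a i
  base≥2⇒long i 2≤b = ≤-trans (a₃≥2 2<n) (at≤ 2 2<n i 2≤i)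
    where
    2≤i : 2 ≤ toℕ i
    2≤i = ≤-trans 2≤b (≤-trans (≤-reflexive (toℕ-fromℕ< (m%n<n (toℕ i) 4))) (m%n≤m (toℕ i) 4))
    2<n : 2 < n
    2<n = ≤-<-trans 2≤i (toℕ<n i)

  -- A digit e + 1 forces the index of the leg to be at least 4(e + 1)3^k, where the length
  -- hypotheses and monotonicity apply.
  place< : ∀ i k e → digit (quotient i) k ≡ suc e → place k e < a i
  place< i k e d≡ = ≤-trans (room e) (fits e (≤-trans (≤-reflexive (regroup (suc (toℕ e)) (3 ^ k)))
                      (≤-trans (*-monoˡ-≤ 4 (digit⇒≤ (quotient i) k e d≡)) (m/n*n≤m (toℕ i) 4))))
    where
    regroup : ∀ x y → 4 * x * y ≡ x * y * 4
    regroup = solve-∀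
    bound : Fin 2 → ℕ
    bound e = 2 * k + 3 + toℕ e
    room : ∀ e → place k e < bound e
    room e = ≤-reflexive (arith k (toℕ e))
      where
      arith : ∀ k x → suc (2 + (k * 2 + x)) ≡ 2 * k + 3 + x
      arith = solve-∀
    fits : ∀ e → 4 * suc (toℕ e) * 3 ^ k ≤ toℕ i → bound e ≤ a i
    fits 0F le = ≤-trans (≤-reflexive (+-identityʳ _))
      (≤-trans (proj₁ (long k (<⇒≤ p)) p) (at≤ _ p i le))
      where
      p : 4 * 3 ^ k < n
      p = ≤-<-trans le (toℕ<n i)
    fits 1F le = ≤-trans (≤-reflexive (+-assoc (2 * k) 3 1))
      (≤-trans (proj₂ (long k (≤-trans (*-monoˡ-≤ (3 ^ k) (m≤m+n 4 4)) (<⇒≤ p))) p) (at≤ _ p i le))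
      where
      p : 8 * 3 ^ k < n
      p = ≤-<-trans le (toℕ<n i)

  colourℕ : V → ℕ
  colourℕ hub       = 0
  colourℕ (leg i j) = legColour (filler (base i)) (quotient i) (toℕ j)

  small< : ∀ {x} → x < 3 → x < t + 3
  small< x<3 = <-≤-trans x<3 (m≤n+m 3 t)

  special< : ∀ {k} → k < t → 3 + k < t + 3
  special< k<t = ≤-trans (s≤s (s≤s (s≤s k<t))) (≤-reflexive (+-comm 3 t))

  digit≢0⇒k<t : ∀ i k e → digit (quotient i) k ≡ suc e → k < t
  digit≢0⇒k<t i k e d≡ = ≰⇒> λ t≤k →
    <⇒≱ (quotient< i) (≤-trans (^-monoʳ-≤ 3 t≤k) (≤-trans (m≤m+n (3 ^ k) _) (digit⇒≤ (quotient i) k e d≡)))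

  colourℕ< : ∀ v → colourℕ v < t + 3
  colourℕ< hub = small< z<s
  colourℕ< (leg i j) with legView (filler (base i)) (quotient i) (toℕ j)
  ... | special k e d≡ _ c≡ = subst (_< t + 3) (sym c≡) (special< (digit≢0⇒k<t i k e d≡))
  ... | filling c≡ = subst (_< t + 3) (sym c≡) (small< (filler<3 (base i) (parity (toℕ j))))

  private
    instance
      t+3-nonZero : NonZero (t + 3)
      t+3-nonZero = >-nonZero (small< z<s)

  -- A total conversion that is injective on the colours in use, so that the arguments below can
  -- work with numbers.
  class : ℕ → Fin (t + 3)
  class x = x mod (t + 3)

  class-injective : ∀ {x y} → x < t + 3 → y < t + 3 → class x ≡ class y → x ≡ y
  class-injective {x} {y} x< y< e =
    trans (sym (m<n⇒m%n≡m x<)) (trans (mod-≡⇒%-≡ x y (t + 3) e) (m<n⇒m%n≡m y<))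

  colour : V → Fin (t + 3)
  colour v = class (colourℕ v)

  colour-proper : Proper _~_ (t + 3) colour
  colour-proper u v u~v e = colourℕ-proper u~v (class-injective (colourℕ< u) (colourℕ< v) e)
    where
    colourℕ-proper : ∀ {u v} → u ~ v → colourℕ u ≢ colourℕ v
    colourℕ-proper (hub-leg i j j≡0)   e rewrite j≡0 = filler-first≢0 (base i) (sym e)
    colourℕ-proper (leg-hub i j j≡0)   e rewrite j≡0 = filler-first≢0 (base i) e
    colourℕ-proper (out i j j′ j′≡)    e rewrite sym j′≡ = legColour-alternates (base i) (quotient i) (toℕ j) e
    colourℕ-proper (inw i j j′ j′≡)    e rewrite sym j′≡ = legColour-alternates (base i) (quotient i) (toℕ j) (sym e)

  private
    D : ℕ → V → ℕ → Set
    D x = DistToClass _~_ colour (class x)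
    _≋_ = SameCode _~_ colour

  D-intro : ∀ {x m u} → x < t + 3 → ∀ v → colourℕ v ≡ x → dist u v ≡ m →
            (∀ w → colourℕ w ≡ x → m ≤ dist u w) → D x u m
  D-intro x< v cv refl min =
    DistToClass-intro v (cong class cv) (λ w cw → min w (class-injective (colourℕ< w) x< cw))

  ≋⇒≤dist : ∀ {x m u v} → u ≋ v → D x u m → ∀ w → colourℕ w ≡ x → m ≤ dist v w
  ≋⇒≤dist s Dm w cw = SameCode⇒≤dist s Dm w (cong class cw)

  -- Colours near the hub and distances to the missing colour

  colourℕ-vertex : ∀ i {p} (p< : p < a i) →
                   colourℕ (vertex i p<) ≡ legColour (filler (base i)) (quotient i) p
  colourℕ-vertex i p< = cong (legColour (filler (base i)) (quotient i)) (toℕ-fromℕ< p<)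

  base-fromℕ< : ∀ {m} (m<n : m < n) → base (fromℕ< m<n) ≡ m mod 4
  base-fromℕ< m<n = cong (_mod 4) (toℕ-fromℕ< m<n)

  quotient-fromℕ< : ∀ {m} (m<n : m < n) → quotient (fromℕ< m<n) ≡ m / 4
  quotient-fromℕ< m<n = cong (_/ 4) (toℕ-fromℕ< m<n)

  1<n : 1 < n
  1<n = 2≤n

  0<n : 0 < n
  0<n = <⇒≤ 1<n

  leg₀ leg₁ : Fin n
  leg₀ = fromℕ< 0<n
  leg₁ = fromℕ< 1<n

  colourℕ-first : ∀ i {b} → base i ≡ b → colourℕ (first i) ≡ filler b 0ℙ
  colourℕ-first i refl = colourℕ-vertex i (a≥1 i)

  1<a : ∀ i {b} → base i ≡ b → 2 ≤ toℕ b → 1 < a i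
  1<a i refl = base≥2⇒long i

  colourℕ-second : ∀ i {b} (bi : base i ≡ b) (2≤b : 2 ≤ toℕ b) → colourℕ (vertex i (1<a i bi 2≤b)) ≡ filler b 1ℙ
  colourℕ-second i refl 2≤b = colourℕ-vertex i (1<a i refl 2≤b)

  colourℕ-first₀ : colourℕ (first leg₀) ≡ 1
  colourℕ-first₀ = colourℕ-first leg₀ (base-fromℕ< 0<n)

  colourℕ-first₁ : colourℕ (first leg₁) ≡ 2
  colourℕ-first₁ = colourℕ-first leg₁ (base-fromℕ< 1<n)

  missing-far : ∀ {i b} j → base i ≡ b → ∀ i′ j′ → colourℕ (leg i′ j′) ≡ missing b →
                suc (toℕ j) + suc (toℕ j′) ≤ dist (leg i j) (leg i′ j′)
  missing-far {i} j refl i′ j′ c≡ with i FP.≟ i′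
  ... | yes refl = contradiction c≡ (legColour≢missing (base i) (quotient i) (toℕ j′))
  ... | no _     = ≤-refl

  -- The missing colour is neither on the leg nor at the hub, but occurs on a neighbour of the hub:
  -- the distance is the depth plus 1.
  D-missing-01 : ∀ {i b m} j → base i ≡ b → missing b ≢ 0 → (m<n : m < n) → i ≢ fromℕ< m<n →
                 colourℕ (first (fromℕ< m<n)) ≡ missing b →
                 D (missing b) (leg i j) (suc (toℕ j) + 1)
  D-missing-01 {i} {b} j bi ≢0 m<n i≢ c≡ = D-intro (small< (missing<3 b)) (first (fromℕ< m<n)) c≡ (dist-other-vertex j (a≥1 _) i≢) nearest
    where
    nearest : ∀ w → colourℕ w ≡ missing b → suc (toℕ j) + 1 ≤ dist (leg i j) w
    nearest hub         e = contradiction (sym e) ≢0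
    nearest (leg i′ j′) e = ≤-trans (+-monoʳ-≤ (suc (toℕ j)) (s≤s z≤n)) (missing-far j bi i′ j′ e)

  base≢⇒≢ : ∀ {i i′ b b′} → base i ≡ b → base i′ ≡ b′ → b ≢ b′ → i ≢ i′
  base≢⇒≢ refl refl ne refl = ne refl

  D-missing-0 : ∀ {i} j → base i ≡ 0F → D 2 (leg i j) (suc (toℕ j) + 1)
  D-missing-0 j bi = D-missing-01 j bi (λ ()) 1<n (base≢⇒≢ bi (base-fromℕ< 1<n) λ ()) colourℕ-first₁

  D-missing-1 : ∀ {i} j → base i ≡ 1F → D 1 (leg i j) (suc (toℕ j) + 1)
  D-missing-1 j bi = D-missing-01 j bi (λ ()) 0<n (base≢⇒≢ bi (base-fromℕ< 0<n) λ ()) colourℕ-first₀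

  -- The missing colour is the hub's, so the distance is the depth itself.
  D-missing-23 : ∀ {i b} j → base i ≡ b → missing b ≡ 0 → D 0 (leg i j) (suc (toℕ j))
  D-missing-23 {i} {b} j bi ≡0 = D-intro (small< z<s) hub refl refl nearest
    where
    nearest : ∀ w → colourℕ w ≡ 0 → suc (toℕ j) ≤ dist (leg i j) w
    nearest hub         e = ≤-refl
    nearest (leg i′ j′) e = ≤-trans (m≤m+n _ _) (missing-far j bi i′ j′ (trans e (sym ≡0)))

  -- At the colour missing from its leg, a vertex has distance at least 2 (bases 0, 1) or at least 1
  -- (bases 2, 3), where the hub has 1 or 0.
  hub≋̸leg : ∀ i j → ¬ (leg i j ≋ hub)
  hub≋̸leg i j s = by-base (base i) refl
    where
    dist-first : ∀ i → dist hub (first i) ≡ 1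
    dist-first i = cong suc (toℕ-fromℕ< (a≥1 i))
    too-far : ∀ {x} → D x (leg i j) (suc (toℕ j) + 1) → ∀ i′ → colourℕ (first i′) ≡ x → ⊥
    too-far Dx i′ e = <⇒≱ (s≤s (m≤n+m 1 (toℕ j)))
      (≤-trans (≋⇒≤dist s Dx (first i′) e) (≤-reflexive (dist-first i′)))
    by-base : ∀ b → base i ≡ b → ⊥
    by-base 0F bi = too-far (D-missing-0 j bi) leg₁ colourℕ-first₁
    by-base 1F bi = too-far (D-missing-1 j bi) leg₀ colourℕ-first₀
    by-base 2F bi = <⇒≱ z<s (≋⇒≤dist s (D-missing-23 j bi refl) hub refl)
    by-base 3F bi = <⇒≱ z<s (≋⇒≤dist s (D-missing-23 j bi refl) hub refl)

  same-missing : ∀ {x o i j i′ j′} → leg i j ≋ leg i′ j′ →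
                 D x (leg i j) (suc (toℕ j) + o) → D x (leg i′ j′) (suc (toℕ j′) + o) → toℕ j ≡ toℕ j′
  same-missing {o = o} s Du Dv = suc-injective (+-cancelʳ-≡ o _ _ (SameCode-≡ s Du Dv))

  -- A leg of base 0 or 1 against one of base 2 or 3: the latter has the former's
  -- missing colour within its first two positions.
  01≋̸23 : ∀ {i j i′ j′ x b′ p} → leg i j ≋ leg i′ j′ →
          D x (leg i j) (suc (toℕ j) + 1) → base i′ ≡ b′ → missing b′ ≡ 0 →
          p ≤ 1 → (p< : p < a i′) → colourℕ (vertex i′ p<) ≡ x → ⊥
  01≋̸23 {i} {j} {i′} {j′} {p = p} s Du bi′ ≡0 p≤1 p< e = <-irrefl refl (begin-strict
    suc (toℕ j)                      <⟨ n<1+n _ ⟩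
    suc (suc (toℕ j))                ≡⟨ +-comm 1 (suc (toℕ j)) ⟩
    suc (toℕ j) + 1                  ≤⟨ ≋⇒≤dist s Du (vertex i′ p<) e ⟩
    dist (leg i′ j′) (vertex i′ p<)  ≡⟨ dist-vertex i′ j′ p< ⟩
    ∣ toℕ j′ - p ∣                   ≤⟨ ∣m-n∣≤m+n (toℕ j′) p ⟩
    toℕ j′ + p                       ≤⟨ +-monoʳ-≤ (toℕ j′) p≤1 ⟩
    toℕ j′ + 1                       ≡⟨ +-comm (toℕ j′) 1 ⟩
    -- Colour 0 measures the depth of the second vertex exactly, and the hub bounds the first
    -- vertex's distance to it.
    suc (toℕ j′)                     ≤⟨ ≋⇒≤dist (SameCode-sym s) (D-missing-23 j′ bi′ ≡0) hub refl ⟩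
    suc (toℕ j)                      ∎)
    where open ≤-Reasoning

  -- Each leg starts with the colour missing from the other, so each vertex would be strictly deeper
  -- than the other.
  0≋̸1 : ∀ {i j i′ j′} → leg i j ≋ leg i′ j′ → base i ≡ 0F → base i′ ≡ 1F → ⊥
  0≋̸1 {i} {j} {i′} {j′} s bi bi′ = <-asym
    (beyond s (D-missing-0 j bi) (colourℕ-first i′ bi′))
    (beyond (SameCode-sym s) (D-missing-1 j′ bi′) (colourℕ-first i bi))
    where
    beyond : ∀ {x i j i′ j′} → leg i j ≋ leg i′ j′ →
             D x (leg i j) (suc (toℕ j) + 1) → colourℕ (first i′) ≡ x → toℕ j < toℕ j′
    beyond {i′ = i′} {j′} s Du e = ≤-trans (m≤m+n _ 1)
      (≤-trans (≋⇒≤dist s Du (first i′) e)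
        (≤-reflexive (trans (dist-vertex i′ j′ (a≥1 i′)) (∣-∣-identityʳ _))))

  -- Colour 1 occurs within the first two positions of the leg, which is closer than any vertex
  -- beyond the hub.
  colour-1-in-leg : ∀ {i b p m} j → base i ≡ b → p ≤ 1 → (p< : p < a i) → colourℕ (vertex i p<) ≡ 1 →
                    D 1 (leg i j) m →
                    ∃ λ q → filler b (parity q) ≡ 1 × ∣ toℕ j - q ∣ ≡ m
  colour-1-in-leg {i} {p = p} {m} j refl p≤1 p< cp Dm with DistToClass⇒nearest Dm
  ... | hub , cw , _ with () ← class-injective (small< z<s) (small< (s≤s z<s)) cw
  ... | leg i′ j′ , cw , d≡ with i FP.≟ i′
  ...   | yes refl = toℕ j′ ,
    legColour<3 (base i) (quotient i) (toℕ j′) (s≤s z<s) (class-injective (colourℕ< (leg i j′)) (small< (s≤s z<s)) cw) , d≡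
  ...   | no _ = contradiction (≤-reflexive d≡) (<⇒≱ (begin-strict
    m                             ≤⟨ DistToClass⇒≤dist Dm (vertex i p<) (cong class cp) ⟩
    dist (leg i j) (vertex i p<)  ≡⟨ dist-vertex i j p< ⟩
    ∣ toℕ j - p ∣                 ≤⟨ ∣m-n∣≤m+n (toℕ j) p ⟩
    toℕ j + p                     ≤⟨ +-monoʳ-≤ (toℕ j) p≤1 ⟩
    toℕ j + 1                     ≤⟨ +-monoʳ-≤ (toℕ j) (s≤s z≤n) ⟩
    toℕ j + suc (toℕ j′)          <⟨ n<1+n _ ⟩
    suc (toℕ j) + suc (toℕ j′)    ∎))
    where open ≤-Reasoning

  -- The depths agree by colour 0. Colour 1 sits at even positions for base 2 and at odd ones for
  -- base 3, so its distances differ in parity.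
  2≋̸3 : ∀ {i j i′ j′} → leg i j ≋ leg i′ j′ → base i ≡ 2F → base i′ ≡ 3F → ⊥
  2≋̸3 {i} {j} {i′} {j′} s bi bi′ with distance-to-class colour (class 1) (leg i j)
  ... | inj₂ none = none (first i) (cong class (colourℕ-first i bi))
  ... | inj₁ (m , Dm)
      with colour-1-in-leg j bi z≤n (a≥1 i) (colourℕ-first i bi) Dm
         | colour-1-in-leg j′ bi′ ≤-refl (1<a i′ bi′ (m≤m+n 2 1)) (colourℕ-second i′ bi′ (m≤m+n 2 1)) (proj₁ (s _ _) Dm)
  ...   | q , cq , q≡ | q′ , cq′ , q′≡ = different cq cq′
          (∣-∣≡⇒parity≡ (toℕ j) q q′ (trans q≡ (trans (sym q′≡) (cong (λ p → ∣ p - q′ ∣) (sym j≡j′)))))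
    where
    j≡j′ : toℕ j ≡ toℕ j′
    j≡j′ = suc-injective (SameCode-≡ s (D-missing-23 j bi refl) (D-missing-23 j′ bi′ refl))
    different : ∀ {p p′} → filler 2F p ≡ 1 → filler 3F p′ ≡ 1 → p ≢ p′
    different {0ℙ} {0ℙ} _ () _
    different {0ℙ} {1ℙ} _ _ ()
    different {1ℙ} {_} () _ _

  ≋⇒same-base : ∀ {i j i′ j′} → leg i j ≋ leg i′ j′ → toℕ j ≡ toℕ j′ × base i ≡ base i′
  ≋⇒same-base {i} {j} {i′} {j′} s = by-base (base i) (base i′) refl refl
    where
    s⁻¹ = SameCode-sym s
    conclude : ∀ {b} → base i ≡ b → base i′ ≡ b → toℕ j ≡ toℕ j′ → toℕ j ≡ toℕ j′ × base i ≡ base i′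
    conclude bi bi′ e = e , trans bi (sym bi′)
    by-base : ∀ b b′ → base i ≡ b → base i′ ≡ b′ → toℕ j ≡ toℕ j′ × base i ≡ base i′
    by-base 0F 0F bi bi′ = conclude bi bi′ (same-missing s (D-missing-0 j bi) (D-missing-0 j′ bi′))
    by-base 0F 1F bi bi′ = ⊥-elim (0≋̸1 s bi bi′)
    by-base 0F 2F bi bi′ = ⊥-elim (01≋̸23 s (D-missing-0 j bi) bi′ refl ≤-refl (1<a i′ bi′ ≤-refl) (colourℕ-second i′ bi′ ≤-refl))
    by-base 0F 3F bi bi′ = ⊥-elim (01≋̸23 s (D-missing-0 j bi) bi′ refl z≤n (a≥1 i′) (colourℕ-first i′ bi′))
    by-base 1F 0F bi bi′ = ⊥-elim (0≋̸1 s⁻¹ bi′ bi)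
    by-base 1F 1F bi bi′ = conclude bi bi′ (same-missing s (D-missing-1 j bi) (D-missing-1 j′ bi′))
    by-base 1F 2F bi bi′ = ⊥-elim (01≋̸23 s (D-missing-1 j bi) bi′ refl z≤n (a≥1 i′) (colourℕ-first i′ bi′))
    by-base 1F 3F bi bi′ = ⊥-elim (01≋̸23 s (D-missing-1 j bi) bi′ refl ≤-refl (1<a i′ bi′ (m≤m+n 2 1)) (colourℕ-second i′ bi′ (m≤m+n 2 1)))
    by-base 2F 0F bi bi′ = ⊥-elim (01≋̸23 s⁻¹ (D-missing-0 j′ bi′) bi refl ≤-refl (1<a i bi ≤-refl) (colourℕ-second i bi ≤-refl))
    by-base 2F 1F bi bi′ = ⊥-elim (01≋̸23 s⁻¹ (D-missing-1 j′ bi′) bi refl z≤n (a≥1 i) (colourℕ-first i bi))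
    by-base 2F 2F bi bi′ = conclude bi bi′ (suc-injective (SameCode-≡ s (D-missing-23 j bi refl) (D-missing-23 j′ bi′ refl)))
    by-base 2F 3F bi bi′ = ⊥-elim (2≋̸3 s bi bi′)
    by-base 3F 0F bi bi′ = ⊥-elim (01≋̸23 s⁻¹ (D-missing-0 j′ bi′) bi refl z≤n (a≥1 i) (colourℕ-first i bi))
    by-base 3F 1F bi bi′ = ⊥-elim (01≋̸23 s⁻¹ (D-missing-1 j′ bi′) bi refl ≤-refl (1<a i bi (m≤m+n 2 1)) (colourℕ-second i bi (m≤m+n 2 1)))
    by-base 3F 2F bi bi′ = ⊥-elim (2≋̸3 s⁻¹ bi′ bi)
    by-base 3F 3F bi bi′ = conclude bi bi′ (suc-injective (SameCode-≡ s (D-missing-23 j bi refl) (D-missing-23 j′ bi′ refl)))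

  -- If the digit is nonzero, the leg's own special vertex is nearest; otherwise the one on leg
  -- 4·3^k is, as no place of colour k + 3 is closer to the hub.
  D-digit : ∀ i j {k} (k<t : k < t) → D (3 + k) (leg i j) (digitDist (toℕ j) k (digit (quotient i) k))
  D-digit i j {k} k<t = by-digit (digit (quotient i) k) refl
    where
    beyond : ∀ i′ j′ → i ≢ i′ → colourℕ (leg i′ j′) ≡ 3 + k → suc (toℕ j) + (3 + k * 2) ≤ dist (leg i j) (leg i′ j′)
    beyond i′ j′ i≢i′ e rewrite dist-diff {a = a} j j′ i≢i′
      with e′ , _ , j′≡ ← legColour≡3+k (base i′) (quotient i′) (toℕ j′) k e rewrite j′≡ =
        +-monoʳ-≤ (suc (toℕ j)) (≤1+place k e′)
    by-digit : ∀ d → digit (quotient i) k ≡ d → D (3 + k) (leg i j) (digitDist (toℕ j) k d)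
    by-digit 0F d≡ = D-intro (special< k<t) (vertex i₀ p<)
        (trans (colourℕ-vertex i₀ p<) (legColour-special (filler (base i₀)) (quotient i₀) k 0F digit₀))
        (trans (dist-other-vertex j p< i≢i₀) (cong (λ x → suc (toℕ j) + (3 + x)) (+-identityʳ (k * 2)))) nearest
      where
      4·3^k<n : 4 * 3 ^ k < n
      -- Minimality of t guarantees that this leg exists.
      4·3^k<n = ≰⇒> (minimal k k<t)
      i₀ = fromℕ< 4·3^k<n
      digit₀ : digit (quotient i₀) k ≡ 1F
      digit₀ = trans (cong (λ q → digit q k) (trans (quotient-fromℕ< 4·3^k<n)
        (trans (cong (_/ 4) (*-comm 4 (3 ^ k))) (m*n/n≡m (3 ^ k) 4)))) (digit-3^ k)
      p< : place k 0F < a i₀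
      p< = place< i₀ k 0F digit₀
      i≢i₀ : i ≢ i₀
      i≢i₀ refl with () ← trans (sym d≡) digit₀
      nearest : ∀ w → colourℕ w ≡ 3 + k → suc (toℕ j) + (3 + k * 2) ≤ dist (leg i j) w
      nearest (leg i′ j′) e = beyond i′ j′ i≢i′ e
        where
        i≢i′ : i ≢ i′
        i≢i′ refl with e′ , d≡′ , _ ← legColour≡3+k (base i) (quotient i) (toℕ j′) k e
          with () ← trans (sym d≡) d≡′
    by-digit (suc e) d≡ = D-intro (special< k<t) (vertex i p<)
        (trans (colourℕ-vertex i p<) (legColour-special (filler (base i)) (quotient i) k e d≡))
        (dist-vertex i j p<) nearest
      where
      p< : place k e < a i
      p< = place< i k e d≡
      nearest : ∀ w → colourℕ w ≡ 3 + k → ∣ toℕ j - place k e ∣ ≤ dist (leg i j) w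
      nearest (leg i′ j′) c≡ = by-leg (i FP.≟ i′)
        where
        by-leg : Dec (i ≡ i′) → ∣ toℕ j - place k e ∣ ≤ dist (leg i j) (leg i′ j′)
        by-leg (no i≢i′) = ≤-trans (<⇒≤ (∣-place∣< (toℕ j) k e)) (beyond i′ j′ i≢i′ c≡)
        by-leg (yes refl) with e′ , d≡′ , j′≡ ← legColour≡3+k (base i) (quotient i) (toℕ j′) k c≡
          with refl ← FP.suc-injective (trans (sym d≡) d≡′) =
            ≤-reflexive (trans (cong (λ q → ∣ toℕ j - q ∣) (sym j′≡)) (sym (dist-same i j j′)))

  -- Depth and base come first; at equal depth the special colours give all digits of i / 4, which
  -- together with i mod 4 determine the leg.
  ≋⇒≡ : ∀ u v → u ≋ v → u ≡ v
  ≋⇒≡ hub       hub         s = refl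
  ≋⇒≡ hub       (leg i j)   s = ⊥-elim (hub≋̸leg i j (SameCode-sym s))
  ≋⇒≡ (leg i j) hub         s = ⊥-elim (hub≋̸leg i j s)
  ≋⇒≡ (leg i j) (leg i′ j′) s with j≡ , b≡ ← ≋⇒same-base s
    with refl ← toℕ-injective {i = i} {j = i′} (/-%-injective (toℕ i) (toℕ i′) 4 (mod-≡⇒%-≡ (toℕ i) (toℕ i′) 4 b≡)
      (digits-injective t (quotient i) (quotient i′) (quotient< i) (quotient< i′) λ k k<t →
        digitDist-injective (toℕ j) k _ _ (trans (SameCode-≡ s (D-digit i j k<t) (D-digit i′ j′ k<t))
          (cong (λ p → digitDist p k (digit (quotient i′) k)) (sym j≡)))))
    with refl ← toℕ-injective j≡ = refl

  colour-locating : Locating _~_ (t + 3) colour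
  colour-locating = colour-proper , ≋⇒≡

theorem9 : (n : ℕ) → 2 ≤ n → (a : Fin n → ℕ) →
    (∀ i → 1 ≤ a i) →
    (∀ i j → i F.≤ j → a i ≤ a j) →
    ((p : 2 < n) → 2 ≤ at a 2 p) →
    (∀ k → 4 * 3 ^ k ≤ n →
      ((p : 4 * 3 ^ k < n) → 2 * k + 3 ≤ at a (4 * 3 ^ k) p) ×
      ((p : 8 * 3 ^ k < n) → 2 * k + 4 ≤ at a (8 * 3 ^ k) p)) →
    ∀ t → CeilLog3Quarter n t →
    LocChromNum (PalmAdj n a) (t + 3)
theorem9 n 2≤n a a≥1 mono a₃≥2 long t (n≤4·3^t , minimal) =
  (colour 2≤n a≥1 mono a₃≥2 long n≤4·3^t minimal ,
   colour-locating 2≤n a≥1 mono a₃≥2 long n≤4·3^t minimal) ,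
  no-locating-colouring 2≤n a≥1 t minimal
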